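{- Let $a,m$ be integers with $1<a<m$ and $\gcd(a,m)=1$, let $\Lambda(a,m)=\{(x,y)\in\mathbb{Z}\times\mathbb{Z}\mid ax+y\equiv 0 \pmod m\}$, and let $\widehat{\mathcal{X}_0},\dots,\widehat{\mathcal{X}_N}$ be the s-states of Qin's algorithm on input $(a,m)$, with inner products $\mathcal{I}_0,\dots,\mathcal{I}_N$. (1) If the inner product changes sign, i.e. there is an index $k_0$ with $0\le k_0<N$, $\mathcal{I}_{k_0}<0$ and $\mathcal{I}_{k_0+1}\ge 0$, then at least one of the row vectors $\widehat{v}_1^{(k_0)},\widehat{v}_2^{(k_0)},\widehat{v}_1^{(k_0+1)},\widehat{v}_2^{(k_0+1)}$ of the two s-states $\widehat{\mathcal{X}_{k_0}}$ and $\widehat{\mathcal{X}_{k_0+1}}$ is a shortest non-zero vector of $\Lambda(a,m)$. (2) If the inner product does not change sign, i.e. $\mathcal{I}_k<0$ for all $0\le k\le N$, then the first row $\widehat{v}_1^{(N)}$ of the terminating s-state $\widehat{\mathcal{X}_N}$ is a shortest non-zero vector of $\Lambda(a,m)$.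
   Context: Lengths are Euclidean: $\|(x,y)\|^2=x^2+y^2$. A shortest non-zero vector of $\Lambda(a,m)$ is a non-zero element of $\Lambda(a,m)$ of minimal length. Qin's algorithm on input $(a,m)$ produces states $\mathcal{X}_k=\begin{pmatrix} x_{11}^{(k)} & x_{12}^{(k)}\\ x_{21}^{(k)} & x_{22}^{(k)}\end{pmatrix}$, starting from $\mathcal{X}_0=\begin{pmatrix}1&a\\0&m\end{pmatrix}$. For $k\ge 1$: - if $k$ is odd, $q_k=\left\lfloor \frac{x_{22}^{(k-1)}-1}{x_{12}^{(k-1)}}\right\rfloor$, $x_{21}^{(k)}=x_{21}^{(k-1)}+q_kx_{11}^{(k-1)}$, $x_{22}^{(k)}=x_{22}^{(k-1)}-q_kx_{12}^{(k-1)}$, and the first row is unchanged; - if $k$ is even, $q_k=\left\lfloor \frac{x_{12}^{(k-1)}-1}{x_{22}^{(k-1)}}\right\rfloor$, $x_{11}^{(k)}=x_{11}^{(k-1)}+q_kx_{21}^{(k-1)}$, $x_{12}^{(k)}=x_{12}^{(k-1)}-q_kx_{22}^{(k-1)}$, and the second row is unchanged. The algorithm terminates as soon as the upper right entry $x_{12}^{(k)}$ equals $1$; $N$ denotes the index of this terminating state. The s-state is $\widehat{\mathcal{X}_k}=\begin{pmatrix} x_{11}^{(k)} & -x_{12}^{(k)}\\ x_{21}^{(k)} & x_{22}^{(k)}\end{pmatrix}$, with row vectors $\widehat{v}_1^{(k)}=(x_{11}^{(k)},-x_{12}^{(k)})$ and $\widehat{v}_2^{(k)}=(x_{21}^{(k)},x_{22}^{(k)})$.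 The inner product is $\mathcal{I}_k=\langle\widehat{v}_1^{(k)},\widehat{v}_2^{(k)}\rangle=x_{11}^{(k)}x_{21}^{(k)}-x_{12}^{(k)}x_{22}^{(k)}$, for $0\le k\le N$. One has $\mathcal{I}_0=-am<0$. -}

module Defs where

open import Data.Empty using (⊥-elim)
open import Data.Integer
  using (ℤ; +_; +0; +[1+_]; -[1+_]; _+_; _*_; _-_; -_; _≤_; _<_; 0ℤ; 1ℤ; _/ℕ_; _⊖_; +<+)
open import Data.Integer.Divisibility.Signed using (_∣_)
open import Data.Integer.GCD using (gcd)
import Data.Integer.Properties as ℤ
open import Data.Nat as ℕ using (ℕ; zero; suc; parity)
open import Data.Nat.Coprimality as ℕ using (Coprime)
import Data.Nat.Divisibility as ℕ
import Data.Nat.DivMod as ℕ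
import Data.Nat.Induction as ℕ
import Data.Nat.Properties as ℕ
open import Data.Parity.Base using (Parity; 0ℙ; 1ℙ)
open import Data.Product using (∃-syntax; _×_; _,_)
open import Data.Sum using (inj₁; inj₂)
open import Induction.WellFounded using (Acc; acc)
open import Level using (0ℓ)
open import Relation.Binary.PropositionalEquality
open import Relation.Unary using (Pred; _∈_)

Vector : Set
Vector = ℤ × ℤ

𝟎 : Vector
𝟎 = 0ℤ , 0ℤ

⟨_,_⟩ : Vector → Vector → ℤ
⟨ (x , y) , (x′ , y′) ⟩ = x * x′ + y * y′

-- The squared Euclidean length.  Comparing lengths is comparing these.
‖_‖² : Vector → ℤ
‖ x , y ‖² = x * x + y * y

Λ : ℤ → ℤ → Pred Vector 0ℓ
Λ a m (x , y) = m ∣ a * x + y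

record IsShortestNonZero (L : Pred Vector 0ℓ) (v : Vector) : Set where
  field
    member  : v ∈ L
    nonZero : v ≢ 𝟎
    minimal : ∀ w → w ∈ L → w ≢ 𝟎 → ‖ v ‖² ≤ ‖ w ‖²

-- The floor of i / j.  The value 0 for j = 0 is a convention that is never
-- used: the divisors met below are positive whenever a and m are.
⌊_÷_⌋ : ℤ → ℤ → ℤ
⌊ i ÷ +0 ⌋       = 0ℤ
⌊ i ÷ +[1+ n ] ⌋ = i /ℕ suc n
⌊ i ÷ -[1+ n ] ⌋ = (- i) /ℕ suc n

record State : Set where
  constructor mkState
  field
    x₁₁ x₁₂ x₂₁ x₂₂ : ℤ

open State public

initial : ℤ → ℤ → State
initial a m = mkState 1ℤ a
                      0ℤ m

reduceRow₂ : State → State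
reduceRow₂ X = record X { x₂₁ = x₂₁ X + q * x₁₁ X ; x₂₂ = x₂₂ X - q * x₁₂ X }
  where
  q : ℤ
  q = ⌊ x₂₂ X - 1ℤ ÷ x₁₂ X ⌋

reduceRow₁ : State → State
reduceRow₁ X = record X { x₁₁ = x₁₁ X + q * x₂₁ X ; x₁₂ = x₁₂ X - q * x₂₂ X }
  where
  q : ℤ
  q = ⌊ x₁₂ X - 1ℤ ÷ x₂₂ X ⌋

step : Parity → State → State
step 1ℙ = reduceRow₂
step 0ℙ = reduceRow₁

-- The recurrence is run for all k; the algorithm's states are those up to the
-- index N with TerminatesAt a m N.
state : ℤ → ℤ → ℕ → State
state a m zero    = initial a m
state a m (suc k) = step (parity (suc k)) (state a m k)

record TerminatesAt (a m : ℤ) (N : ℕ) : Set where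
  field
    stops   : x₁₂ (state a m N) ≡ 1ℤ
    earlier : ∀ k → k ℕ.< N → x₁₂ (state a m k) ≢ 1ℤ

v̂₁ : State → Vector
v̂₁ X = x₁₁ X , - x₁₂ X

v̂₂ : State → Vector
v̂₂ X = x₂₁ X , x₂₂ X

𝓘 : ℤ → ℤ → ℕ → ℤ
𝓘 a m k = ⟨ v̂₁ (state a m k) , v̂₂ (state a m k) ⟩

private

  reduce : ∀ p r → + suc r - ⌊ + suc r - 1ℤ ÷ +[1+ p ] ⌋ * +[1+ p ] ≡ + suc (r ℕ.% suc p)
  reduce p r = begin
    + suc r - + (r ℕ./ suc p) * + suc p
      ≡⟨ cong (λ t → + suc r - t) (ℤ.pos-* (r ℕ./ suc p) (suc p)) ⟨
    + suc r - + (r ℕ./ suc p ℕ.* suc p)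
      ≡⟨ ℤ.m-n≡m⊖n (suc r) (r ℕ./ suc p ℕ.* suc p) ⟩
    suc r ⊖ (r ℕ./ suc p ℕ.* suc p)
      ≡⟨ ℤ.⊖-≥ (ℕ.≤-trans (ℕ.m/n*n≤m r (suc p)) (ℕ.n≤1+n r)) ⟩
    + (suc r ℕ.∸ r ℕ./ suc p ℕ.* suc p)
      ≡⟨ cong +_ (ℕ.+-∸-assoc 1 (ℕ.m/n*n≤m r (suc p))) ⟩
    + suc (r ℕ.∸ r ℕ./ suc p ℕ.* suc p)
      ≡⟨ cong +[1+_] (ℕ.m%n≡m∸m/n*n r (suc p)) ⟨
    + suc (r ℕ.% suc p) ∎
    where open ≡-Reasoning

  coprime-reduce : ∀ p r → Coprime (suc p) (suc r) → Coprime (suc p) (suc (r ℕ.% suc p))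
  coprime-reduce p r c {d} (d∣p , d∣r) = c (d∣p , subst (d ℕ.∣_) (sym eq)
    (ℕ.∣m∣n⇒∣m+n d∣r (ℕ.∣n⇒∣m*n (r ℕ./ suc p) d∣p)))
    where
    eq : suc r ≡ suc (r ℕ.% suc p) ℕ.+ r ℕ./ suc p ℕ.* suc p
    eq = cong suc (ℕ.m≡m%n+[m/n]*n r (suc p))

  module _ (a m : ℤ) where

    -- Two consecutive steps, the first of odd index, from right column (p+2, r+1).
    terminates-from : ∀ {p} → Acc ℕ._<_ p → ∀ k r →
      parity (suc k) ≡ 1ℙ → parity k ≡ 0ℙ →
      x₁₂ (state a m k) ≡ + suc p → x₂₂ (state a m k) ≡ + suc r →
      Coprime (suc p) (suc r) →
      (∀ j → j ℕ.< k → x₁₂ (state a m j) ≢ 1ℤ) →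
      ∃[ N ] TerminatesAt a m N
    terminates-from {zero} _ k r _ _ x₁₂≡ _ _ earlier =
      k , record { stops = x₁₂≡ ; earlier = earlier }
    terminates-from {suc p} (acc rs) k r odd even x₁₂≡ x₂₂≡ c earlier =
      terminates-from (rs p″<p) (suc (suc k)) r′ odd even
        x₁₂″ x₂₂″ (ℕ.sym (coprime-reduce r′ (suc p) (ℕ.sym c′))) earlier′
      where
      r′ = r ℕ.% suc (suc p)
      c′ : Coprime (suc (suc p)) (suc r′)
      c′ = coprime-reduce (suc p) r c

      x₁₂′ : x₁₂ (state a m (suc k)) ≡ + suc (suc p)
      x₁₂′ rewrite odd = x₁₂≡

      x₂₂′ : x₂₂ (state a m (suc k)) ≡ + suc r′
      x₂₂′ rewrite odd | x₁₂≡ | x₂₂≡ = reduce (suc p) r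

      x₁₂″ : x₁₂ (state a m (suc (suc k))) ≡ + suc (suc p ℕ.% suc r′)
      x₁₂″ rewrite even = trans
        (cong₂ (λ x y → x - ⌊ x - 1ℤ ÷ y ⌋ * y) x₁₂′ x₂₂′) (reduce r′ (suc p))

      x₂₂″ : x₂₂ (state a m (suc (suc k))) ≡ + suc r′
      x₂₂″ rewrite even = x₂₂′

      r′≢ : r′ ≢ suc p
      r′≢ eq with () ← c′ (ℕ.∣-refl , ℕ.∣-reflexive (cong suc (sym eq)))

      p″<p : suc p ℕ.% suc r′ ℕ.< suc p
      p″<p = ℕ.≤-<-trans (ℕ.≤-pred (ℕ.m%n<n (suc p) (suc r′)))
               (ℕ.≤∧≢⇒< (ℕ.≤-pred (ℕ.m%n<n r (suc (suc p)))) r′≢)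

      earlier′ : ∀ j → j ℕ.< suc (suc k) → x₁₂ (state a m j) ≢ 1ℤ
      earlier′ j j<2+k eq with ℕ.m<1+n⇒m<n∨m≡n j<2+k
      ... | inj₂ refl with () ← trans (sym x₁₂′) eq
      ... | inj₁ j<1+k with ℕ.m<1+n⇒m<n∨m≡n j<1+k
      ...   | inj₁ j<k = earlier j j<k eq
      ...   | inj₂ refl with () ← trans (sym x₁₂≡) eq

-- The terminating index exists, so N in the theorem ranges over exactly one value.
terminates : ∀ a m → 1ℤ < a → a < m → gcd a m ≡ 1ℤ → ∃[ N ] TerminatesAt a m N
terminates (+ suc p) (+ suc r) _ _ coprime =
  terminates-from (+ suc p) (+ suc r) (ℕ.<-wellFounded p) 0 r refl refl refl refl
    (ℕ.gcd≡1⇒coprime (ℤ.+-injective coprime)) (λ _ ())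
terminates (+ zero) _ (+<+ ())
terminates -[1+ _ ] _ ()
terminates (+ suc _) (+ zero) _ (+<+ ())
terminates (+ suc _) -[1+ _ ] _ ()

{-# OPTIONS --safe #-}

-- The rows f, g of every s-state form a basis of Λ(a,m), so a lattice vector is
-- w = s f + t g, and ‖w‖² = s²‖f‖² + 2 s t ⟨f,g⟩ + t²‖g‖² is at least ‖f‖² or ‖g‖²
-- whenever s t ⟨f,g⟩ ≥ 0.  If g is replaced by g′ = g + q f and the inner product
-- changes sign, this applies to (f,g) when s t ≤ 0 and, because
-- w = (s − q t) f + t g′, to (f,g′) when (s − q t) t ≥ 0.  Up to w ↦ −w what is left is
-- 0 < s < q t, and there the sign pattern of the rows makes both coordinates of w at
-- least as large in absolute value as those of f.
-- Without sign change, f = (u,−1) and g = (v,r) with u v < r at the end.  Then v ≥ 1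
-- gives u ≤ r, hence ‖f‖ ≤ ‖g‖, which settles s t ≤ 0; for s, t > 0 the first
-- coordinate of w is at least u + 1, and (u + 1)² ≥ u² + 1.
module Submission where

open import Defs
open import Data.Integer
  using (ℤ; +_; +0; +[1+_]; -[1+_]; _+_; _*_; _-_; -_; _≤_; _<_; 0ℤ; 1ℤ; -≤+; +≤+; +<+)
open import Data.Integer.Divisibility.Signed using (divides)
import Data.Integer.DivMod as ℤ
open import Data.Integer.GCD using (gcd)
import Data.Integer.Properties as ℤ
open import Data.Integer.Tactic.RingSolver using (solve-∀)
open import Data.Nat as ℕ using (ℕ; zero; suc; parity; z≤n; s≤s)
import Data.Nat.DivMod as ℕ
import Data.Nat.Properties as ℕ
open import Data.Parity.Base using (0ℙ; 1ℙ)
open import Data.Product using (_×_; _,_; ∃₂; proj₁; proj₂)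
open import Data.Sum as Sum using (_⊎_; inj₁; inj₂; [_,_]′)
open import Function using (_∘_)
open import Level using (0ℓ)
open import Relation.Binary.PropositionalEquality
open import Relation.Nullary using (contradiction; yes; no)
open import Relation.Unary using (Pred; _∈_)

-- Integer inequalities and signs.

-- Used with a certificate: `d` is assembled from terms known to be nonnegative, and the equation is
-- a ring identity.
≤-by-difference : ∀ {i j d} → 0ℤ ≤ d → j - i ≡ d → i ≤ j
≤-by-difference 0≤d eq = ℤ.0≤i-j⇒j≤i (subst (0ℤ ≤_) (sym eq) 0≤d)

+-nonNeg : ∀ {i j} → 0ℤ ≤ i → 0ℤ ≤ j → 0ℤ ≤ i + j
+-nonNeg = ℤ.+-mono-≤

*-nonNeg : ∀ {i j} → 0ℤ ≤ i → 0ℤ ≤ j → 0ℤ ≤ i * j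
*-nonNeg {+ m} {+ n} (+≤+ _) (+≤+ _) = subst (0ℤ ≤_) (ℤ.pos-* m n) (+≤+ z≤n)

*-nonPos : ∀ {i j} → i ≤ 0ℤ → j ≤ 0ℤ → 0ℤ ≤ i * j
*-nonPos {i} {j} i≤0 j≤0 =
  subst (0ℤ ≤_) (eq i j) (*-nonNeg (ℤ.neg-mono-≤ i≤0) (ℤ.neg-mono-≤ j≤0))
  where
  eq : ∀ i j → (- i) * (- j) ≡ i * j
  eq = solve-∀

positive-pred : ∀ {i} → 0ℤ < i → 0ℤ ≤ i - 1ℤ
positive-pred 0<i = ℤ.i≤j⇒0≤j-i (ℤ.i<j⇒suc[i]≤j 0<i)

square-nonNeg : ∀ i → 0ℤ ≤ i * i
square-nonNeg +0       = ℤ.≤-refl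
square-nonNeg +[1+ _ ] = +≤+ z≤n
square-nonNeg -[1+ _ ] = +≤+ z≤n

square-pred-nonNeg : ∀ {i} → i ≢ 0ℤ → 0ℤ ≤ i * i - 1ℤ
square-pred-nonNeg {+0}        i≢0 = contradiction refl i≢0
square-pred-nonNeg {+[1+ _ ]}  _   = +≤+ z≤n
square-pred-nonNeg { -[1+ _ ]} _   = +≤+ z≤n

square-mono-≤ : ∀ {i j} → 0ℤ ≤ i → i ≤ j → i * i ≤ j * j
square-mono-≤ {i} {j} 0≤i i≤j = ≤-by-difference
  (*-nonNeg (ℤ.i≤j⇒0≤j-i i≤j) (+-nonNeg 0≤i (ℤ.≤-trans 0≤i i≤j))) (eq i j)
  where
  eq : ∀ i j → j * j - i * i ≡ (j - i) * (i + j)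
  eq = solve-∀

-- The case of two negative numbers is returned for `- i` and `- j`, ready for the symmetry between
-- a vector and its negative.
signs : ∀ i j → i * j ≤ 0ℤ ⊎ (0ℤ < i × 0ℤ < j) ⊎ (0ℤ < - i × 0ℤ < - j)
signs +0       _        = inj₁ ℤ.≤-refl
signs i        +0       = inj₁ (ℤ.≤-reflexive (ℤ.*-zeroʳ i))
signs +[1+ _ ] +[1+ _ ] = inj₂ (inj₁ (+<+ (s≤s z≤n) , +<+ (s≤s z≤n)))
signs +[1+ _ ] -[1+ _ ] = inj₁ -≤+
signs -[1+ _ ] +[1+ _ ] = inj₁ -≤+
signs -[1+ _ ] -[1+ _ ] = inj₂ (inj₂ (+<+ (s≤s z≤n) , +<+ (s≤s z≤n)))

-- Norms of integer combinations of two vectors.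

⟨,⟩-comm : ∀ f g → ⟨ f , g ⟩ ≡ ⟨ g , f ⟩
⟨,⟩-comm (f₁ , f₂) (g₁ , g₂) = cong₂ _+_ (ℤ.*-comm f₁ g₁) (ℤ.*-comm f₂ g₂)

‖‖²-nonNeg : ∀ f → 0ℤ ≤ ‖ f ‖²
‖‖²-nonNeg (x , y) = +-nonNeg (square-nonNeg x) (square-nonNeg y)

combine : ℤ → Vector → ℤ → Vector → Vector
combine s (f₁ , f₂) t (g₁ , g₂) = s * f₁ + t * g₁ , s * f₂ + t * g₂

‖‖²-combine : ∀ s f t g →
  ‖ combine s f t g ‖² ≡
    s * s * ‖ f ‖² + (s * t * ⟨ f , g ⟩ + s * t * ⟨ f , g ⟩) + t * t * ‖ g ‖²
‖‖²-combine s (f₁ , f₂) t (g₁ , g₂) = eq s f₁ f₂ t g₁ g₂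
  where
  eq : ∀ s f₁ f₂ t g₁ g₂ →
    (s * f₁ + t * g₁) * (s * f₁ + t * g₁) + (s * f₂ + t * g₂) * (s * f₂ + t * g₂) ≡
    s * s * (f₁ * f₁ + f₂ * f₂)
      + (s * t * (f₁ * g₁ + f₂ * g₂) + s * t * (f₁ * g₁ + f₂ * g₂))
      + t * t * (g₁ * g₁ + g₂ * g₂)
  eq = solve-∀

‖‖²-combine-neg : ∀ s f t g → ‖ combine (- s) f (- t) g ‖² ≡ ‖ combine s f t g ‖²
‖‖²-combine-neg s (f₁ , f₂) t (g₁ , g₂) = eq s f₁ f₂ t g₁ g₂
  where
  eq : ∀ s f₁ f₂ t g₁ g₂ →
    ((- s) * f₁ + (- t) * g₁) * ((- s) * f₁ + (- t) * g₁)
      + ((- s) * f₂ + (- t) * g₂) * ((- s) * f₂ + (- t) * g₂) ≡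
    (s * f₁ + t * g₁) * (s * f₁ + t * g₁) + (s * f₂ + t * g₂) * (s * f₂ + t * g₂)
  eq = solve-∀

combine-comm : ∀ s f t g → combine s f t g ≡ combine t g s f
combine-comm s (f₁ , f₂) t (g₁ , g₂) =
  cong₂ _,_ (ℤ.+-comm (s * f₁) (t * g₁)) (ℤ.+-comm (s * f₂) (t * g₂))

combine-nonZero : ∀ s f t g → combine s f t g ≢ 𝟎 → s ≢ 0ℤ ⊎ t ≢ 0ℤ
combine-nonZero +0       f t g ≢𝟎 = inj₂ λ { refl → ≢𝟎 refl }
combine-nonZero +[1+ _ ] _ _ _ _  = inj₁ λ ()
combine-nonZero -[1+ _ ] _ _ _ _  = inj₁ λ ()

-- Every term of the expanded norm is nonnegative, and a nonzero integer has square at least 1, so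
-- the term of a nonzero coefficient alone reaches `‖ f ‖²` or `‖ g ‖²`.
cross-nonNeg⇒longer : ∀ s f t g → s ≢ 0ℤ ⊎ t ≢ 0ℤ → 0ℤ ≤ s * t * ⟨ f , g ⟩ →
  ‖ f ‖² ≤ ‖ combine s f t g ‖² ⊎ ‖ g ‖² ≤ ‖ combine s f t g ‖²
cross-nonNeg⇒longer s f t g (inj₁ s≢0) 0≤K = inj₁ (≤-by-difference
  (+-nonNeg (+-nonNeg (*-nonNeg (square-pred-nonNeg s≢0) (‖‖²-nonNeg f)) (+-nonNeg 0≤K 0≤K))
            (*-nonNeg (square-nonNeg t) (‖‖²-nonNeg g)))
  (trans (cong (_- ‖ f ‖²) (‖‖²-combine s f t g))
         (eq (s * s) ‖ f ‖² (s * t * ⟨ f , g ⟩) (t * t * ‖ g ‖²))))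
  where
  eq : ∀ A F K B → A * F + (K + K) + B - F ≡ (A - 1ℤ) * F + (K + K) + B
  eq = solve-∀
cross-nonNeg⇒longer s f t g (inj₂ t≢0) 0≤K = inj₂ (≤-by-difference
  (+-nonNeg (+-nonNeg (*-nonNeg (square-nonNeg s) (‖‖²-nonNeg f)) (+-nonNeg 0≤K 0≤K))
            (*-nonNeg (square-pred-nonNeg t≢0) (‖‖²-nonNeg g)))
  (trans (cong (_- ‖ g ‖²) (‖‖²-combine s f t g))
         (eq (s * s * ‖ f ‖²) (s * t * ⟨ f , g ⟩) (t * t) ‖ g ‖²)))
  where
  eq : ∀ B K A G → B + (K + K) + A * G - G ≡ B + (K + K) + (A - 1ℤ) * G
  eq = solve-∀

-- Two bases related by a shear.

-- Abstract vectors let one argument serve both parities: `f` is the row that the step keeps, and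
-- `g` the row that becomes `g′`. The signs of the entries enter only through `between`.
module SignChange
  (q : ℤ) (f g g′ : Vector)
  (g′≡ : g′ ≡ combine q f 1ℤ g)
  (obtuse : ⟨ f , g ⟩ ≤ 0ℤ)
  (acute : 0ℤ ≤ ⟨ f , g′ ⟩)
  (between : ∀ s t → 0ℤ < s → 0ℤ < t → s < q * t → ‖ f ‖² ≤ ‖ combine s f t g ‖²)
  where

  combine-shear : ∀ s t → combine (s - q * t) f t g′ ≡ combine s f t g
  combine-shear s t rewrite g′≡ =
    cong₂ _,_ (eq q s t (proj₁ f) (proj₁ g)) (eq q s t (proj₂ f) (proj₂ g))
    where
    eq : ∀ q s t x y → (s - q * t) * x + t * (q * x + 1ℤ * y) ≡ s * x + t * y
    eq = solve-∀

  Bound : Vector → Set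
  Bound w = ‖ f ‖² ≤ ‖ w ‖² ⊎ ‖ g ‖² ≤ ‖ w ‖² ⊎ ‖ g′ ‖² ≤ ‖ w ‖²

  bound⁺ : ∀ s t → 0ℤ < s → 0ℤ < t → Bound (combine s f t g)
  bound⁺ s t 0<s 0<t with s ℤ.<? q * t
  ... | yes s<qt = inj₁ (between s t 0<s 0<t s<qt)
  ... | no  s≮qt = Sum.map₂ inj₂
    (subst (λ w → ‖ f ‖² ≤ ‖ w ‖² ⊎ ‖ g′ ‖² ≤ ‖ w ‖²) (combine-shear s t)
      -- `s - q * t` may vanish, so `t` serves as the nonzero coefficient.
      (cross-nonNeg⇒longer (s - q * t) f t g′ (inj₂ λ { refl → ℤ.<-irrefl refl 0<t })
        (*-nonNeg (*-nonNeg (ℤ.i≤j⇒0≤j-i (ℤ.≮⇒≥ s≮qt)) (ℤ.<⇒≤ 0<t)) acute)))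

  bound : ∀ s t → combine s f t g ≢ 𝟎 → Bound (combine s f t g)
  bound s t ≢𝟎 with signs s t
  ... | inj₂ (inj₁ (0<s , 0<t)) = bound⁺ s t 0<s 0<t
  ... | inj₂ (inj₂ (0<-s , 0<-t)) =
    subst (λ n → ‖ f ‖² ≤ n ⊎ ‖ g ‖² ≤ n ⊎ ‖ g′ ‖² ≤ n) (‖‖²-combine-neg s f t g)
      (bound⁺ (- s) (- t) 0<-s 0<-t)
  ... | inj₁ st≤0 = Sum.map₂ inj₁
    (cross-nonNeg⇒longer s f t g (combine-nonZero s f t g ≢𝟎) (*-nonPos st≤0 obtuse))

-- The least of three lattice vectors.

module _ {L : Pred Vector 0ℓ} {e₁ e₂ e₃ : Vector}
  (m₁ : e₁ ∈ L) (m₂ : e₂ ∈ L) (m₃ : e₃ ∈ L)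
  (n₁ : e₁ ≢ 𝟎) (n₂ : e₂ ≢ 𝟎) (n₃ : e₃ ≢ 𝟎)
  (bound : ∀ w → w ∈ L → w ≢ 𝟎 →
    ‖ e₁ ‖² ≤ ‖ w ‖² ⊎ ‖ e₂ ‖² ≤ ‖ w ‖² ⊎ ‖ e₃ ‖² ≤ ‖ w ‖²)
  where

  least⇒shortest : ∀ {e} → e ∈ L → e ≢ 𝟎 →
    ‖ e ‖² ≤ ‖ e₁ ‖² → ‖ e ‖² ≤ ‖ e₂ ‖² → ‖ e ‖² ≤ ‖ e₃ ‖² → IsShortestNonZero L e
  least⇒shortest {e} e∈L e≢𝟎 ≤₁ ≤₂ ≤₃ = record
    { member = e∈L ; nonZero = e≢𝟎 ; minimal = minimal }
    where
    minimal : ∀ w → w ∈ L → w ≢ 𝟎 → ‖ e ‖² ≤ ‖ w ‖²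
    minimal w w∈L w≢𝟎 with bound w w∈L w≢𝟎
    ... | inj₁ ≤w        = ℤ.≤-trans ≤₁ ≤w
    ... | inj₂ (inj₁ ≤w) = ℤ.≤-trans ≤₂ ≤w
    ... | inj₂ (inj₂ ≤w) = ℤ.≤-trans ≤₃ ≤w

  -- Every nonzero lattice vector is at least as long as one of the three, hence as the least of
  -- them.
  shortest-of-three :
    IsShortestNonZero L e₁ ⊎ IsShortestNonZero L e₂ ⊎ IsShortestNonZero L e₃
  shortest-of-three
    with ℤ.≤-total ‖ e₁ ‖² ‖ e₂ ‖² | ℤ.≤-total ‖ e₁ ‖² ‖ e₃ ‖² | ℤ.≤-total ‖ e₂ ‖² ‖ e₃ ‖²
  ... | inj₁ ≤₂ | inj₁ ≤₃ | _       = inj₁ (least⇒shortest m₁ n₁ ℤ.≤-refl ≤₂ ≤₃)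
  ... | inj₁ ≤₂ | inj₂ ≤₁ | _       =
    inj₂ (inj₂ (least⇒shortest m₃ n₃ ≤₁ (ℤ.≤-trans ≤₁ ≤₂) ℤ.≤-refl))
  ... | inj₂ ≤₁ | _       | inj₁ ≤₃ = inj₂ (inj₁ (least⇒shortest m₂ n₂ ≤₁ ℤ.≤-refl ≤₃))
  ... | inj₂ ≤₁ | _       | inj₂ ≤₂ =
    inj₂ (inj₂ (least⇒shortest m₃ n₃ (ℤ.≤-trans ≤₂ ≤₁) ≤₂ ℤ.≤-refl))

-- Positivity and unimodularity along the algorithm.

quotient-nonNeg : ∀ {i j} → 0ℤ < i → 0ℤ < j → 0ℤ ≤ ⌊ i - 1ℤ ÷ j ⌋
quotient-nonNeg {+[1+ _ ]} {+[1+ _ ]} _ _ = +≤+ z≤n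
quotient-nonNeg {+0} (+<+ ())
quotient-nonNeg {+[1+ _ ]} {+0} _ (+<+ ())

-- Dividing `i - 1ℤ` rather than `i` moves the remainders from 0, ..., `j` - 1 to 1, ..., `j`: the
-- result is 1 plus the remainder of `i - 1ℤ`.
reduced-positive : ∀ {i j} → 0ℤ < i → 0ℤ < j → 0ℤ < i - ⌊ i - 1ℤ ÷ j ⌋ * j
reduced-positive {+[1+ r ]} {+[1+ p ]} _ _ =
  subst (0ℤ <_) (sym eq) (+<+ (s≤s z≤n))
  where
  q = + (r ℕ./ suc p)
  rearrange : ∀ e q j → 1ℤ + (e + q * j) - q * j ≡ 1ℤ + e
  rearrange = solve-∀
  eq : +[1+ r ] - q * +[1+ p ] ≡ +[1+ r ℕ.% suc p ]
  eq = trans (cong (λ i → 1ℤ + i - q * +[1+ p ]) (ℤ.a≡a%ℕn+[a/ℕn]*n (+ r) (suc p)))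
             (rearrange (+ (r ℕ.% suc p)) q +[1+ p ])
reduced-positive {+0} (+<+ ())
reduced-positive {+[1+ _ ]} {+0} _ (+<+ ())

-- The rows v̂₁, v̂₂ are the images of (x₁₁ , α) and (x₂₁ , β) under the parametrisation
-- (x , k) ↦ (x , k m − a x) of Λ(a,m) by ℤ², so unimodularity of that pair says that
-- the rows form a basis.
record Invariant (a m : ℤ) (X : State) : Set where
  field
    α β        : ℤ
    x₁₂≡       : x₁₂ X ≡ a * x₁₁ X - α * m
    x₂₂≡       : x₂₂ X ≡ β * m - a * x₂₁ X
    unimodular : β * x₁₁ X - α * x₂₁ X ≡ 1ℤ
    0≤x₁₁      : 0ℤ ≤ x₁₁ X
    0<x₁₂      : 0ℤ < x₁₂ X
    0≤x₂₁      : 0ℤ ≤ x₂₁ X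
    0<x₂₂      : 0ℤ < x₂₂ X

initial-invariant : ∀ {a m} → 0ℤ < a → 0ℤ < m → Invariant a m (initial a m)
initial-invariant {a} {m} 0<a 0<m = record
  -- The pairs `(x₁₁ , α)` and `(x₂₁ , β)` start as the standard basis of ℤ².
  { α = 0ℤ ; β = 1ℤ
  ; x₁₂≡ = eq₁ a m ; x₂₂≡ = eq₂ a m ; unimodular = refl
  ; 0≤x₁₁ = +≤+ z≤n ; 0<x₁₂ = 0<a ; 0≤x₂₁ = ℤ.≤-refl ; 0<x₂₂ = 0<m
  }
  where
  eq₁ : ∀ a m → a ≡ a * 1ℤ - 0ℤ * m
  eq₁ = solve-∀
  eq₂ : ∀ a m → m ≡ 1ℤ * m - a * 0ℤ
  eq₂ = solve-∀

-- With the sign of `x₁₂` in `v̂₁`, a step adds `q` times one row to the other. The cofactors `α`,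
-- `β` undergo the same row operation, which preserves the determinant.
step-invariant : ∀ {a m} π {X} → Invariant a m X → Invariant a m (step π X)
step-invariant {a} {m} 1ℙ {mkState u p v r} I = record
  { α = α ; β = β + q * α
  ; x₁₂≡ = x₁₂≡
  ; x₂₂≡ = trans (cong₂ (λ r p → r - q * p) x₂₂≡ x₁₂≡) (eq₂ a m u v α β q)
  ; unimodular = trans (eq₃ u v α β q) unimodular
  ; 0≤x₁₁ = 0≤x₁₁ ; 0<x₁₂ = 0<x₁₂
  ; 0≤x₂₁ = +-nonNeg 0≤x₂₁ (*-nonNeg (quotient-nonNeg 0<x₂₂ 0<x₁₂) 0≤x₁₁)
  ; 0<x₂₂ = reduced-positive 0<x₂₂ 0<x₁₂
  }
  where
  open Invariant I
  q = ⌊ r - 1ℤ ÷ p ⌋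
  eq₂ : ∀ a m u v α β q →
    (β * m - a * v) - q * (a * u - α * m) ≡ (β + q * α) * m - a * (v + q * u)
  eq₂ = solve-∀
  eq₃ : ∀ u v α β q → (β + q * α) * u - α * (v + q * u) ≡ β * u - α * v
  eq₃ = solve-∀
step-invariant {a} {m} 0ℙ {mkState u p v r} I = record
  { α = α + q * β ; β = β
  ; x₁₂≡ = trans (cong₂ (λ p r → p - q * r) x₁₂≡ x₂₂≡) (eq₂ a m u v α β q)
  ; x₂₂≡ = x₂₂≡
  ; unimodular = trans (eq₃ u v α β q) unimodular
  ; 0≤x₁₁ = +-nonNeg 0≤x₁₁ (*-nonNeg (quotient-nonNeg 0<x₁₂ 0<x₂₂) 0≤x₂₁)
  ; 0<x₁₂ = reduced-positive 0<x₁₂ 0<x₂₂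
  ; 0≤x₂₁ = 0≤x₂₁ ; 0<x₂₂ = 0<x₂₂
  }
  where
  open Invariant I
  q = ⌊ p - 1ℤ ÷ r ⌋
  eq₂ : ∀ a m u v α β q →
    (a * u - α * m) - q * (β * m - a * v) ≡ a * (u + q * v) - (α + q * β) * m
  eq₂ = solve-∀
  eq₃ : ∀ u v α β q → β * (u + q * v) - (α + q * β) * v ≡ β * u - α * v
  eq₃ = solve-∀

state-invariant : ∀ {a m} → 0ℤ < a → 0ℤ < m → ∀ k → Invariant a m (state a m k)
state-invariant 0<a 0<m zero    = initial-invariant 0<a 0<m
state-invariant 0<a 0<m (suc k) =
  step-invariant (parity (suc k)) (state-invariant 0<a 0<m k)

-- The rows as a basis of the lattice.

module Basis {a m : ℤ} {X : State} (I : Invariant a m X) where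
  open Invariant I

  v̂₁∈Λ : v̂₁ X ∈ Λ a m
  v̂₁∈Λ = divides α (trans (cong (λ p → a * x₁₁ X + - p) x₁₂≡) (eq a m (x₁₁ X) α))
    where
    eq : ∀ a m u α → a * u + - (a * u - α * m) ≡ α * m
    eq = solve-∀

  v̂₂∈Λ : v̂₂ X ∈ Λ a m
  v̂₂∈Λ = divides β (trans (cong (λ r → a * x₂₁ X + r) x₂₂≡) (eq a m (x₂₁ X) β))
    where
    eq : ∀ a m v β → a * v + (β * m - a * v) ≡ β * m
    eq = solve-∀

  v̂₁≢𝟎 : v̂₁ X ≢ 𝟎
  v̂₁≢𝟎 eq = ℤ.<-irrefl (sym (ℤ.neg-injective (cong proj₂ eq))) 0<x₁₂

  v̂₂≢𝟎 : v̂₂ X ≢ 𝟎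
  v̂₂≢𝟎 eq = ℤ.<-irrefl (sym (cong proj₂ eq)) 0<x₂₂

  -- Cramer's rule for `(x , k)` in terms of `(x₁₁ , α)` and `(x₂₁ , β)`; the determinant is 1, so
  -- no division occurs.
  spans : ∀ w → w ∈ Λ a m → ∃₂ λ s t → w ≡ combine s (v̂₁ X) t (v̂₂ X)
  spans (x , y) (divides k ax+y≡km) = x * β - k * v , u * k - α * x , cong₂ _,_ x≡ y≡
    where
    open ≡-Reasoning
    u = x₁₁ X
    v = x₂₁ X

    eq₁ : ∀ x k u v α β →
      x * (β * u - α * v) ≡ (x * β - k * v) * u + (u * k - α * x) * v
    eq₁ = solve-∀

    eq₂ : ∀ a m x k u v α β →
      (k * m - a * x) * (β * u - α * v) ≡
      (x * β - k * v) * - (a * u - α * m) + (u * k - α * x) * (β * m - a * v)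
    eq₂ = solve-∀

    eq₃ : ∀ a x y → y ≡ a * x + y - a * x
    eq₃ = solve-∀

    -- Multiplying by the determinant, which is 1, reduces each coordinate to a polynomial identity.
    x≡ : x ≡ (x * β - k * v) * u + (u * k - α * x) * v
    x≡ = begin
      x                                         ≡⟨ ℤ.*-identityʳ x ⟨
      x * 1ℤ                                    ≡⟨ cong (x *_) unimodular ⟨
      x * (β * u - α * v)                       ≡⟨ eq₁ x k u v α β ⟩
      (x * β - k * v) * u + (u * k - α * x) * v ∎

    y≡ : y ≡ (x * β - k * v) * - x₁₂ X + (u * k - α * x) * x₂₂ X
    y≡ = begin
      y                                   ≡⟨ eq₃ a x y ⟩
      a * x + y - a * x                   ≡⟨ cong (_- a * x) ax+y≡km ⟩
      k * m - a * x                       ≡⟨ ℤ.*-identityʳ _ ⟨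
      (k * m - a * x) * 1ℤ                ≡⟨ cong ((k * m - a * x) *_) unimodular ⟨
      (k * m - a * x) * (β * u - α * v)   ≡⟨ eq₂ a m x k u v α β ⟩
      (x * β - k * v) * - (a * u - α * m) + (u * k - α * x) * (β * m - a * v)
        ≡⟨ cong₂ (λ p r → (x * β - k * v) * - p + (u * k - α * x) * r) x₁₂≡ x₂₂≡ ⟨
      (x * β - k * v) * - x₁₂ X + (u * k - α * x) * x₂₂ X ∎

-- A step at which the inner product changes sign.

-- Second coordinate: t r − s p = t (r − q p) + (q t − s) p ≥ p.
between : ∀ {u p v r q s t} → 0ℤ ≤ u → 0ℤ ≤ p → 0ℤ ≤ v → 0ℤ ≤ r - q * p →
  0ℤ < s → 0ℤ < t → s < q * t →
  u * u + p * p ≤ (s * u + t * v) * (s * u + t * v) + (t * r - s * p) * (t * r - s * p)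
between {u} {p} {v} {r} {q} {s} {t} 0≤u 0≤p 0≤v 0≤r′ 0<s 0<t s<qt = ℤ.+-mono-≤
  (square-mono-≤ {u} {s * u + t * v} 0≤u (≤-by-difference
    (+-nonNeg (*-nonNeg (positive-pred 0<s) 0≤u) (*-nonNeg (ℤ.<⇒≤ 0<t) 0≤v)) (eq₁ s u t v)))
  (square-mono-≤ {p} {t * r - s * p} 0≤p (≤-by-difference
    (+-nonNeg (*-nonNeg (ℤ.<⇒≤ 0<t) 0≤r′)
              (*-nonNeg (ℤ.i≤j⇒0≤j-i (ℤ.i<j⇒suc[i]≤j s<qt)) 0≤p)) (eq₂ p r q s t)))
  where
  eq₁ : ∀ s u t v → s * u + t * v - u ≡ (s - 1ℤ) * u + t * v
  eq₁ = solve-∀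
  eq₂ : ∀ p r q s t → t * r - s * p - p ≡ t * (r - q * p) + (q * t - (1ℤ + s)) * p
  eq₂ = solve-∀

-- One row is common to both states, so the four rows are only three vectors, and
-- `shortest-of-three` applies.
sign-change : ∀ {a m} π X → Invariant a m X →
  ⟨ v̂₁ X , v̂₂ X ⟩ < 0ℤ → 0ℤ ≤ ⟨ v̂₁ (step π X) , v̂₂ (step π X) ⟩ →
  IsShortestNonZero (Λ a m) (v̂₁ X)
  ⊎ IsShortestNonZero (Λ a m) (v̂₂ X)
  ⊎ IsShortestNonZero (Λ a m) (v̂₁ (step π X))
  ⊎ IsShortestNonZero (Λ a m) (v̂₂ (step π X))
sign-change {a} {m} 1ℙ X@(mkState u p v r) I <0 ≥0 =
  Sum.map₂ (Sum.map₂ inj₂) (shortest-of-three {L = Λ a m}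
    v̂₁∈Λ v̂₂∈Λ (Basis.v̂₂∈Λ I′) v̂₁≢𝟎 v̂₂≢𝟎 (Basis.v̂₂≢𝟎 I′) bounded)
  where
  open Basis I
  open Invariant I
  X′ = step 1ℙ X
  I′ = step-invariant 1ℙ I
  q = ⌊ r - 1ℤ ÷ p ⌋

  x₂₁′≡ : ∀ v q u → v + q * u ≡ q * u + 1ℤ * v
  x₂₁′≡ = solve-∀
  x₂₂′≡ : ∀ r q p → r - q * p ≡ q * - p + 1ℤ * r
  x₂₂′≡ = solve-∀

  -- `between` speaks of the positive entries; these identities carry it over to the signed rows.
  flip : ∀ u p v r s t →
    (s * u + t * v) * (s * u + t * v) + (t * r - s * p) * (t * r - s * p) ≡
    (s * u + t * v) * (s * u + t * v) + (s * - p + t * r) * (s * - p + t * r)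
  flip = solve-∀
  flip′ : ∀ u p → u * u + p * p ≡ u * u + - p * - p
  flip′ = solve-∀

  bounded : ∀ w → w ∈ Λ a m → w ≢ 𝟎 →
    ‖ v̂₁ X ‖² ≤ ‖ w ‖² ⊎ ‖ v̂₂ X ‖² ≤ ‖ w ‖² ⊎ ‖ v̂₂ X′ ‖² ≤ ‖ w ‖²
  bounded w w∈Λ w≢𝟎 with spans w w∈Λ
  ... | s , t , refl = SignChange.bound q (v̂₁ X) (v̂₂ X) (v̂₂ X′)
    (cong₂ _,_ (x₂₁′≡ v q u) (x₂₂′≡ r q p)) (ℤ.<⇒≤ <0) ≥0
    (λ s t 0<s 0<t s<qt → subst₂ _≤_ (flip′ u p) (flip u p v r s t)
      (between {q = q} 0≤x₁₁ (ℤ.<⇒≤ 0<x₁₂) 0≤x₂₁ (ℤ.<⇒≤ (Invariant.0<x₂₂ I′)) 0<s 0<t s<qt))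
    s t w≢𝟎

sign-change {a} {m} 0ℙ X@(mkState u p v r) I <0 ≥0 =
  -- An even step keeps the second row, which now plays `f`; the three answers are permuted back.
  [ inj₂ ∘ inj₁ , Sum.map₂ (inj₂ ∘ inj₁) ]′ (shortest-of-three {L = Λ a m}
    v̂₂∈Λ v̂₁∈Λ (Basis.v̂₁∈Λ I′) v̂₂≢𝟎 v̂₁≢𝟎 (Basis.v̂₁≢𝟎 I′) bounded)
  where
  open Basis I
  open Invariant I
  X′ = step 0ℙ X
  I′ = step-invariant 0ℙ I
  q = ⌊ p - 1ℤ ÷ r ⌋

  x₁₁′≡ : ∀ u q v → u + q * v ≡ q * v + 1ℤ * u
  x₁₁′≡ = solve-∀
  x₁₂′≡ : ∀ p q r → - (p - q * r) ≡ q * r + 1ℤ * - p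
  x₁₂′≡ = solve-∀

  -- The second coordinate is here the negative of the one in `between`; squaring hides this.
  flip : ∀ u p v r s t →
    (s * v + t * u) * (s * v + t * u) + (t * p - s * r) * (t * p - s * r) ≡
    (s * v + t * u) * (s * v + t * u) + (s * r + t * - p) * (s * r + t * - p)
  flip = solve-∀

  bounded : ∀ w → w ∈ Λ a m → w ≢ 𝟎 →
    ‖ v̂₂ X ‖² ≤ ‖ w ‖² ⊎ ‖ v̂₁ X ‖² ≤ ‖ w ‖² ⊎ ‖ v̂₁ X′ ‖² ≤ ‖ w ‖²
  bounded w w∈Λ w≢𝟎 with spans w w∈Λ
  ... | s , t , w≡ with refl ← trans w≡ (combine-comm s (v̂₁ X) t (v̂₂ X)) =
    SignChange.bound q (v̂₂ X) (v̂₁ X) (v̂₁ X′)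
    (cong₂ _,_ (x₁₁′≡ u q v) (x₁₂′≡ p q r))
    (ℤ.≤-trans (ℤ.≤-reflexive (⟨,⟩-comm (v̂₂ X) (v̂₁ X))) (ℤ.<⇒≤ <0))
    (ℤ.≤-trans ≥0 (ℤ.≤-reflexive (⟨,⟩-comm (v̂₁ X′) (v̂₂ X′))))
    (λ s t 0<s 0<t s<qt → ℤ.≤-trans
      (between {q = q} 0≤x₂₁ (ℤ.<⇒≤ 0<x₂₂) 0≤x₁₁ (ℤ.<⇒≤ (Invariant.0<x₁₂ I′)) 0<s 0<t s<qt)
      (ℤ.≤-reflexive (flip u p v r s t)))
    t s w≢𝟎

-- Termination with a negative inner product.

quotient-positive : ∀ {i j} → 0ℤ < j → j < i → 0ℤ < ⌊ i - 1ℤ ÷ j ⌋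
quotient-positive {+[1+ _ ]} {+[1+ _ ]} _ (+<+ (s≤s j<i)) = +<+ (ℕ.m≥n⇒m/n>0 j<i)
quotient-positive {+0} {+[1+ _ ]} _ (+<+ ())
quotient-positive {_} {+0} (+<+ ())

step-x₂₁-positive : ∀ {a m} π {X} → Invariant a m X → 0ℤ < x₂₁ X → 0ℤ < x₂₁ (step π X)
step-x₂₁-positive 1ℙ I 0<x₂₁ =
  ℤ.+-mono-<-≤ 0<x₂₁ (*-nonNeg (quotient-nonNeg 0<x₂₂ 0<x₁₂) 0≤x₁₁)
  where open Invariant I
step-x₂₁-positive 0ℙ I 0<x₂₁ = 0<x₂₁

-- The entry starts at 0, becomes `q` ≥ 1 in the first step because `a < m`, and never decreases;
-- hence the index `suc k`.
state-x₂₁-positive : ∀ {a m} → 0ℤ < a → a < m → ∀ k → 0ℤ < x₂₁ (state a m (suc k))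
state-x₂₁-positive 0<a a<m zero =
  subst (0ℤ <_) (sym (trans (ℤ.+-identityˡ _) (ℤ.*-identityʳ _))) (quotient-positive 0<a a<m)
state-x₂₁-positive 0<a a<m (suc k) =
  step-x₂₁-positive (parity (suc (suc k)))
    (state-invariant 0<a (ℤ.<-trans 0<a a<m) (suc k)) (state-x₂₁-positive 0<a a<m k)

no-sign-change : ∀ {a m X} → Invariant a m X → x₁₂ X ≡ 1ℤ → 0ℤ < x₂₁ X →
  ⟨ v̂₁ X , v̂₂ X ⟩ < 0ℤ → IsShortestNonZero (Λ a m) (v̂₁ X)
no-sign-change {a} {m} {X@(mkState u _ v r)} I refl 0<v <0 = record
  { member = v̂₁∈Λ ; nonZero = v̂₁≢𝟎 ; minimal = minimal }
  where
  open Basis I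
  open Invariant I renaming (0≤x₁₁ to 0≤u; 0<x₂₂ to 0<r)

  u≤r : u ≤ r
  u≤r = ≤-by-difference
    (+-nonNeg (ℤ.neg-mono-≤ (ℤ.<⇒≤ <0)) (*-nonNeg 0≤u (positive-pred 0<v))) (eq u v r)
    where
    -- Matching on `x₁₂ X ≡ 1ℤ` has turned `- x₁₂ X` into the literal `-[1+ 0 ]`.
    eq : ∀ u v r → r - u ≡ - (u * v + -[1+ 0 ] * r) + u * (v - 1ℤ)
    eq = solve-∀

  v̂₁≤v̂₂ : ‖ v̂₁ X ‖² ≤ ‖ v̂₂ X ‖²
  -- The coordinates are compared crosswise: 1 with `v` and `u` with `r`.
  v̂₁≤v̂₂ = subst (_≤ ‖ v̂₂ X ‖²) (ℤ.+-comm 1ℤ (u * u))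
    (ℤ.+-mono-≤ (square-mono-≤ {1ℤ} {v} (+≤+ z≤n) (ℤ.i<j⇒suc[i]≤j 0<v))
                (square-mono-≤ {u} {r} 0≤u u≤r))

  minimal⁺ : ∀ s t → 0ℤ < s → 0ℤ < t → ‖ v̂₁ X ‖² ≤ ‖ combine s (v̂₁ X) t (v̂₂ X) ‖²
  minimal⁺ s t 0<s 0<t = ℤ.≤-trans
    (≤-by-difference (+-nonNeg 0≤u 0≤u) (eq₁ u))
    (ℤ.≤-trans (square-mono-≤ {u + 1ℤ} {s * u + t * v} (+-nonNeg 0≤u (+≤+ z≤n))
      (≤-by-difference
        (+-nonNeg (*-nonNeg (positive-pred 0<s) 0≤u)
          (+-nonNeg (*-nonNeg (positive-pred 0<t) (ℤ.<⇒≤ 0<v)) (positive-pred 0<v)))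
        (eq₂ s u t v)))
      -- The first coordinate already suffices, so the square of the second is dropped.
      (≤-by-difference (square-nonNeg (s * -[1+ 0 ] + t * r))
        (eq₃ ((s * u + t * v) * (s * u + t * v)) _)))
    where
    eq₁ : ∀ u → (u + 1ℤ) * (u + 1ℤ) - (u * u + 1ℤ) ≡ u + u
    eq₁ = solve-∀
    eq₂ : ∀ s u t v →
      s * u + t * v - (u + 1ℤ) ≡ (s - 1ℤ) * u + ((t - 1ℤ) * v + (v - 1ℤ))
    eq₂ = solve-∀
    eq₃ : ∀ A B → A + B - A ≡ B
    eq₃ = solve-∀

  minimal : ∀ w → w ∈ Λ a m → w ≢ 𝟎 → ‖ v̂₁ X ‖² ≤ ‖ w ‖²
  minimal w w∈Λ w≢𝟎 with spans w w∈Λ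
  ... | s , t , refl with signs s t
  ...   | inj₂ (inj₁ (0<s , 0<t)) = minimal⁺ s t 0<s 0<t
  ...   | inj₂ (inj₂ (0<-s , 0<-t)) =
    ℤ.≤-trans (minimal⁺ (- s) (- t) 0<-s 0<-t)
      (ℤ.≤-reflexive (‖‖²-combine-neg s (v̂₁ X) t (v̂₂ X)))
  ...   | inj₁ st≤0 = [ (λ ≤w → ≤w) , ℤ.≤-trans v̂₁≤v̂₂ ]′
    (cross-nonNeg⇒longer s (v̂₁ X) t (v̂₂ X) (combine-nonZero s (v̂₁ X) t (v̂₂ X) w≢𝟎)
      (*-nonPos st≤0 (ℤ.<⇒≤ <0)))

theorem1p1 : ∀ (a m : ℤ) → 1ℤ < a → a < m → gcd a m ≡ 1ℤ →
    ∀ (N : ℕ) → TerminatesAt a m N →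
    (∀ (k₀ : ℕ) → k₀ ℕ.< N → 𝓘 a m k₀ < 0ℤ → 0ℤ ≤ 𝓘 a m (suc k₀) →
    IsShortestNonZero (Λ a m) (v̂₁ (state a m k₀))
    ⊎ IsShortestNonZero (Λ a m) (v̂₂ (state a m k₀))
    ⊎ IsShortestNonZero (Λ a m) (v̂₁ (state a m (suc k₀)))
    ⊎ IsShortestNonZero (Λ a m) (v̂₂ (state a m (suc k₀))))
    × ((∀ (k : ℕ) → k ℕ.≤ N → 𝓘 a m k < 0ℤ) →
    IsShortestNonZero (Λ a m) (v̂₁ (state a m N)))
theorem1p1 a m 1<a a<m _ N terminates =
  (λ k₀ _ → sign-change (parity (suc k₀)) (state a m k₀) (invariant k₀)) ,
  last N terminates
  where
  0<a : 0ℤ < a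
  0<a = ℤ.<-trans (+<+ (s≤s z≤n)) 1<a

  invariant : ∀ k → Invariant a m (state a m k)
  invariant = state-invariant 0<a (ℤ.<-trans 0<a a<m)

  last : ∀ N → TerminatesAt a m N → (∀ k → k ℕ.≤ N → 𝓘 a m k < 0ℤ) →
    IsShortestNonZero (Λ a m) (v̂₁ (state a m N))
  -- Stopping at index 0 would mean `a ≡ 1ℤ`. So at least one step is made, and `x₂₁` is positive at
  -- the end.
  last zero    T _  = contradiction 1<a (ℤ.<-irrefl (sym (TerminatesAt.stops T)))
  last (suc N) T <0 = no-sign-change (invariant (suc N)) (TerminatesAt.stops T)
    (state-x₂₁-positive 0<a a<m N) (<0 (suc N) ℕ.≤-refl)
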